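{- Let $E_1$ and $E_2$ be finite sets of closed sentences such that every member of $E_1$ and every member of $E_2$ is certified adoptable, i.e. well-formed and $\omega$-true. Then the merged stock $E_1\cup E_2$ yields no contradiction: there is no term $c$ such that both $E_1\cup E_2\vdash c$ and $E_1\cup E_2\vdash\neg c$ are derivable in OGA.
   Context: **Syntax.** Terms: $t::=v_i\mid\bot\mid\mathbf 0\mid\mathbf S t\mid t=t\mid\neg t\mid t\lor t\mid\lambda t\mid t\cdot t\mid\mathcal R\mid\mathcal A$ ($v_i$, $i\in\mathbb N$, de Bruijn variables; $\lambda$ is the only binder; application associates to the left). A term is well-formed (wf) if generated by this grammar. $\bot$ is a divergent constant, $\mathcal R$ the primitive recursor, $\mathcal A$ the universal quantifier. Abbreviations: $t\,\mathsf N$ is $t=t$; $t\,\mathsf B$ is $t\lor\neg t$; $t\ne u$ is $\neg(t=u)$; $t\land u$ is $\neg(\neg t\lor\neg u)$; $t\to u$ is $\neg t\lor u$; $\underline n=\mathbf S^n\mathbf 0$. $\uparrow$ shifts all free indices up by one; $b[t]$ is the $\beta$-instance substituting $t$ for the outermost bound variable of $b$; $[v\mapsto s]$ is capture-avoiding substitution for a free variable; $\mathrm{fv}$ is the set of free variables. **Head steps** $\triangleright$: $(\lambda b)\cdot t\triangleright b[t]$; $\mathcal R\cdot g\cdot h\cdot\mathbf 0\triangleright g$; $\mathcal R\cdot g\cdot h\cdot(\mathbf S\underline n)\triangleright h\cdot\underline n\cdot(\mathcal R\cdot g\cdot h\cdot\underline n)$; if $t\triangleright t'$ then $t\cdot u\triangleright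 t'\cdot u$. **Rules.** Judgments are $\Gamma\vdash c$, $\Gamma$ a finite set of wf terms, $c$ a wf term (all terms in rules are wf). A proof is a finite list of judgments each following from earlier entries by one rule; $\Gamma\vdash c$ is derivable if it occurs in a proof. Rules ("$\Rightarrow$" from premises to conclusion, "$\Leftrightarrow$" both directions; $\Gamma$ is the context of a judgment when none is shown): $\Gamma,c\vdash c$; $\Gamma\vdash c\Rightarrow\Gamma,a\vdash c$; $\Gamma\vdash a$ and $\Gamma,a\vdash c\Rightarrow\Gamma\vdash c$; $\Gamma\vdash c\Rightarrow[v\mapsto s]\Gamma\vdash[v\mapsto s]c$; $\vdash a\Leftrightarrow\ \vdash a=\underline1$; $\vdash\neg a\Leftrightarrow\ \vdash a=\underline0$; $\vdash\neg a,\ \vdash a\Rightarrow\ \vdash c$; $\vdash a\Leftrightarrow\ \vdash\neg\neg a$; $\vdash a\Rightarrow\ \vdash a\lor b$; $\vdash b\Rightarrow\ \vdash a\lor b$; $\vdash\neg a,\ \vdash\neg b\Rightarrow\ \vdash\neg(a\lor b)$; $\vdash a\lor b,\ \Gamma,a\vdash c,\ \Gamma,b\vdash c\Rightarrow\ \vdash c$; $\vdash\neg(a\lor b)\Rightarrow\ \vdash\neg a$; $\vdash\neg(a\lor b)\Rightarrow\ \vdash\neg b$; $\vdash a\,\mathsf N\Leftrightarrow\ \vdash a=a$; $\vdash a=b\Rightarrow\ \vdash b=a$; $\vdash a=b,\ \vdash[v\mapsto a]p\Rightarrow\ \vdash[v\mapsto b]p$; $\vdash a\ne b\Rightarrow\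 \vdash b\ne a$; $\vdash a\,\mathsf N,\ \vdash b\,\mathsf N\Rightarrow\ \vdash(a=b)\,\mathsf B$; $\vdash(a=b)\,\mathsf B\Rightarrow\ \vdash(a\,\mathsf N)\land(b\,\mathsf N)$; $\vdash\mathbf 0\,\mathsf N$; $\vdash a\,\mathsf N\Leftrightarrow\ \vdash(\mathbf S a)\,\mathsf N$; $\vdash a\,\mathsf N\Rightarrow\ \vdash\mathbf S a\ne\mathbf 0$; $\vdash a\ne b\Leftrightarrow\ \vdash\mathbf S a\ne\mathbf S b$; $\vdash\mathbf S a=\mathbf S b\Rightarrow\ \vdash a=b$; $\vdash\bot\,\mathsf N\Rightarrow\ \vdash p$; induction: $\vdash[v_i\mapsto\mathbf 0]c$, $\ v_i\,\mathsf N,c,\Gamma\vdash[v_i\mapsto\mathbf S v_i]c$, $\ \vdash a\,\mathsf N\Rightarrow\ \vdash[v_i\mapsto a]c$ if $v_i\notin\mathrm{fv}(\Gamma)$; conversion, for $c\triangleright c'$: $\vdash c'\Rightarrow\ \vdash c$; $\vdash c\Rightarrow\ \vdash c'$; $\vdash\neg c\Rightarrow\ \vdash\neg c'$; $\vdash c'\,\mathsf N\Rightarrow\ \vdash c=c'$; $\vdash m\,\mathsf N,\ \vdash(h\cdot m\cdot(\mathcal R\cdot g\cdot h\cdot m))\,\mathsf N\Rightarrow\ \vdash\mathcal R\cdot g\cdot h\cdot(\mathbf S m)=h\cdot m\cdot(\mathcal R\cdot g\cdot h\cdot m)$; $v_0\,\mathsf N,\uparrow\Gamma\vdash\uparrow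 f\cdot v_0\Rightarrow\Gamma\vdash\mathcal A\cdot f$; $\vdash\mathcal A\cdot f,\ \vdash a\,\mathsf N\Rightarrow\ \vdash f\cdot a$; $\vdash\neg(f\cdot a),\ \vdash a\,\mathsf N\Rightarrow\ \vdash\neg(\mathcal A\cdot f)$; $\Gamma\vdash\neg(\mathcal A\cdot f)$ and $v_0\,\mathsf N,\neg(\uparrow f\cdot v_0),\uparrow\Gamma\vdash\uparrow c\Rightarrow\Gamma\vdash c$. These are the rules of RGA. OGA has these and the rule ATI: $\Gamma\vdash\mathcal A\cdot(\lambda((\uparrow u\cdot v_0)\,\mathsf B))\Rightarrow\Gamma\vdash(\mathcal A\cdot u)\,\mathsf B$. **$\omega$-truth.** Let $\Downarrow$ be the least relation between closed terms and naturals such that: $\mathbf 0\Downarrow0$; $t\Downarrow n$ implies $\mathbf S t\Downarrow n+1$; if $t\Downarrow m$, $u\Downarrow n$ then $(t=u)\Downarrow1$ when $m=n$ and $(t=u)\Downarrow0$ when $m\ne n$; $t\Downarrow1$ implies $\neg t\Downarrow0$, and $t\Downarrow0$ implies $\neg t\Downarrow1$; $t\lor u\Downarrow1$ if $t\Downarrow1$ or $u\Downarrow1$, and $t\lor u\Downarrow0$ if $t\Downarrow0$ and $u\Downarrow0$; for any finite list of arguments $\vec s$: $b[t]\cdot\vec s\Downarrow n$ implies $(\lambda b)\cdot t\cdot\vec s\Downarrow n$; if $a\Downarrow0$ and $g\cdot\vec s\Downarrow n$ then $\mathcal R\cdot g\cdot h\cdot a\cdot\vec s\Downarrow n$; if $a\Downarrow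 k+1$ and $h\cdot\underline k\cdot(\mathcal R\cdot g\cdot h\cdot\underline k)\cdot\vec s\Downarrow n$ then $\mathcal R\cdot g\cdot h\cdot a\cdot\vec s\Downarrow n$; $\mathcal A\cdot f\Downarrow1$ if $f\cdot\underline k\Downarrow1$ for all $k\in\mathbb N$; $\mathcal A\cdot f\Downarrow0$ if $f\cdot\underline k\Downarrow0$ for some $k$. A closed term $t$ is $\omega$-true if $t\Downarrow1$. -}

module Defs where

open import Data.Bool using (if_then_else_)
open import Data.Empty using (⊥)
open import Data.List using (List; []; _∷_; map; foldl)
open import Data.List.Relation.Binary.BagAndSetEquality using (_∼[_]_; set)
open import Data.List.Relation.Unary.All using (All)
open import Data.List.Relation.Unary.Any using (Any)
open import Data.Nat using (ℕ; zero; suc; _≟_)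
open import Data.Product using (∃; ∃-syntax; _×_)
open import Data.Sum using (_⊎_)
open import Relation.Binary.PropositionalEquality using (_≡_; _≢_)
open import Relation.Nullary using (¬_; does)

infixl 9 _·_ _·*_
infix  8 ƛ_ 𝐒_
infix  7 _≐_ _≠̇_ _𝐍 _𝐁
infix  6 ¬̇_
infixr 6 _∨̇_ _∧̇_
infix  4 _▷_ _⇓_
infix  2 _⊢_
infix  1 _≋_
infix  1 _⟹ᴿ_ _⟹ᴼ_

-- The datatype is the grammar, so every inhabitant is a well-formed term and
-- "wf" needs no separate predicate.
data Term : Set where
  var  : ℕ → Term
  ⊥̇    : Term
  𝟎    : Term
  𝐒_   : Term → Term
  _≐_  : Term → Term → Term
  ¬̇_   : Term → Term
  _∨̇_  : Term → Term → Term
  ƛ_   : Term → Term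
  _·_  : Term → Term → Term
  𝓡    : Term
  𝓐    : Term

_𝐍 : Term → Term
t 𝐍 = t ≐ t

_𝐁 : Term → Term
t 𝐁 = t ∨̇ (¬̇ t)

_≠̇_ : Term → Term → Term
t ≠̇ u = ¬̇ (t ≐ u)

_∧̇_ : Term → Term → Term
t ∧̇ u = ¬̇ ((¬̇ t) ∨̇ (¬̇ u))

num : ℕ → Term
num zero    = 𝟎
num (suc n) = 𝐒 num n

_·*_ : Term → List Term → Term
_·*_ = foldl _·_

_∈fv_ : ℕ → Term → Set
i ∈fv var j    = i ≡ j
i ∈fv ⊥̇        = ⊥
i ∈fv 𝟎        = ⊥
i ∈fv (𝐒 t)    = i ∈fv t
i ∈fv (t ≐ u)  = i ∈fv t ⊎ i ∈fv u
i ∈fv (¬̇ t)    = i ∈fv t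
i ∈fv (t ∨̇ u)  = i ∈fv t ⊎ i ∈fv u
i ∈fv (ƛ b)    = suc i ∈fv b
i ∈fv (t · u)  = i ∈fv t ⊎ i ∈fv u
i ∈fv 𝓡        = ⊥
i ∈fv 𝓐        = ⊥

Closed : Term → Set
Closed t = ∀ i → ¬ (i ∈fv t)

ext : (ℕ → ℕ) → ℕ → ℕ
ext ρ zero    = zero
ext ρ (suc i) = suc (ρ i)

ren : (ℕ → ℕ) → Term → Term
ren ρ (var i)  = var (ρ i)
ren ρ ⊥̇        = ⊥̇
ren ρ 𝟎        = 𝟎
ren ρ (𝐒 t)    = 𝐒 ren ρ t
ren ρ (t ≐ u)  = ren ρ t ≐ ren ρ u
ren ρ (¬̇ t)    = ¬̇ ren ρ t
ren ρ (t ∨̇ u)  = ren ρ t ∨̇ ren ρ u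
ren ρ (ƛ b)    = ƛ ren (ext ρ) b
ren ρ (t · u)  = ren ρ t · ren ρ u
ren ρ 𝓡        = 𝓡
ren ρ 𝓐        = 𝓐

↑ : Term → Term
↑ = ren suc

exts : (ℕ → Term) → ℕ → Term
exts σ zero    = var zero
exts σ (suc i) = ↑ (σ i)

sub : (ℕ → Term) → Term → Term
sub σ (var i)  = σ i
sub σ ⊥̇        = ⊥̇
sub σ 𝟎        = 𝟎
sub σ (𝐒 t)    = 𝐒 sub σ t
sub σ (t ≐ u)  = sub σ t ≐ sub σ u
sub σ (¬̇ t)    = ¬̇ sub σ t
sub σ (t ∨̇ u)  = sub σ t ∨̇ sub σ u
sub σ (ƛ b)    = ƛ sub (exts σ) b
sub σ (t · u)  = sub σ t · sub σ u
sub σ 𝓡        = 𝓡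
sub σ 𝓐        = 𝓐

-- β-instance: index 0 is replaced and all other free indices drop by one.
_[_] : Term → Term → Term
b [ t ] = sub (λ { zero → t ; (suc i) → var i }) b

-- Substitution for the free variable v: unlike _[_], all other indices stay
-- put, and s may itself mention v.
[_↦_]_ : ℕ → Term → Term → Term
[ v ↦ s ] t = sub (λ j → if does (j ≟ v) then s else var j) t

data _▷_ : Term → Term → Set where
  β   : ∀ {b t} → (ƛ b) · t ▷ b [ t ]
  𝓡𝟎  : ∀ {g h} → 𝓡 · g · h · 𝟎 ▷ g
  𝓡𝐒  : ∀ {g h} n → 𝓡 · g · h · (𝐒 num n) ▷ h · num n · (𝓡 · g · h · num n)
  app : ∀ {t t' u} → t ▷ t' → t · u ▷ t' · u

-- Contexts are finite sets, represented by lists taken up to set equality: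
-- see _≋_.
Context : Set
Context = List Term

data Judgment : Set where
  _⊢_ : Context → Term → Judgment

_≋_ : Judgment → Judgment → Set
(Γ ⊢ c) ≋ (Δ ⊢ d) = (Γ ∼[ set ] Δ) × (c ≡ d)

-- ps ⟹ᴿ J : J follows from the list of premises ps by one rule of RGA.
data _⟹ᴿ_ : List Judgment → Judgment → Set where
  hyp    : ∀ {Γ c} → [] ⟹ᴿ c ∷ Γ ⊢ c
  weaken : ∀ {Γ a c} → (Γ ⊢ c) ∷ [] ⟹ᴿ a ∷ Γ ⊢ c
  cut    : ∀ {Γ a c} → (Γ ⊢ a) ∷ (a ∷ Γ ⊢ c) ∷ [] ⟹ᴿ Γ ⊢ c
  subst  : ∀ {Γ c} v s → (Γ ⊢ c) ∷ [] ⟹ᴿ map [ v ↦ s ]_ Γ ⊢ [ v ↦ s ] c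

  true-I  : ∀ {Γ a} → (Γ ⊢ a) ∷ [] ⟹ᴿ Γ ⊢ a ≐ num 1
  true-E  : ∀ {Γ a} → (Γ ⊢ a ≐ num 1) ∷ [] ⟹ᴿ Γ ⊢ a
  false-I : ∀ {Γ a} → (Γ ⊢ ¬̇ a) ∷ [] ⟹ᴿ Γ ⊢ a ≐ num 0
  false-E : ∀ {Γ a} → (Γ ⊢ a ≐ num 0) ∷ [] ⟹ᴿ Γ ⊢ ¬̇ a

  ¬-E  : ∀ {Γ a c} → (Γ ⊢ ¬̇ a) ∷ (Γ ⊢ a) ∷ [] ⟹ᴿ Γ ⊢ c
  ¬¬-I : ∀ {Γ a} → (Γ ⊢ a) ∷ [] ⟹ᴿ Γ ⊢ ¬̇ ¬̇ a
  ¬¬-E : ∀ {Γ a} → (Γ ⊢ ¬̇ ¬̇ a) ∷ [] ⟹ᴿ Γ ⊢ a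
  ∨-I₁ : ∀ {Γ a b} → (Γ ⊢ a) ∷ [] ⟹ᴿ Γ ⊢ a ∨̇ b
  ∨-I₂ : ∀ {Γ a b} → (Γ ⊢ b) ∷ [] ⟹ᴿ Γ ⊢ a ∨̇ b
  ¬∨-I : ∀ {Γ a b} → (Γ ⊢ ¬̇ a) ∷ (Γ ⊢ ¬̇ b) ∷ [] ⟹ᴿ Γ ⊢ ¬̇ (a ∨̇ b)
  ∨-E  : ∀ {Γ a b c} →
         (Γ ⊢ a ∨̇ b) ∷ (a ∷ Γ ⊢ c) ∷ (b ∷ Γ ⊢ c) ∷ [] ⟹ᴿ Γ ⊢ c
  ¬∨-E₁ : ∀ {Γ a b} → (Γ ⊢ ¬̇ (a ∨̇ b)) ∷ [] ⟹ᴿ Γ ⊢ ¬̇ a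
  ¬∨-E₂ : ∀ {Γ a b} → (Γ ⊢ ¬̇ (a ∨̇ b)) ∷ [] ⟹ᴿ Γ ⊢ ¬̇ b

  -- a 𝐍 and a ≐ a are the same term; the rule is kept for both directions.
  𝐍→≐    : ∀ {Γ a} → (Γ ⊢ a 𝐍) ∷ [] ⟹ᴿ Γ ⊢ a ≐ a
  ≐→𝐍    : ∀ {Γ a} → (Γ ⊢ a ≐ a) ∷ [] ⟹ᴿ Γ ⊢ a 𝐍
  ≐-sym  : ∀ {Γ a b} → (Γ ⊢ a ≐ b) ∷ [] ⟹ᴿ Γ ⊢ b ≐ a
  ≐-subst : ∀ {Γ a b} v p →
            (Γ ⊢ a ≐ b) ∷ (Γ ⊢ [ v ↦ a ] p) ∷ [] ⟹ᴿ Γ ⊢ [ v ↦ b ] p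
  ≠-sym  : ∀ {Γ a b} → (Γ ⊢ a ≠̇ b) ∷ [] ⟹ᴿ Γ ⊢ b ≠̇ a
  ≐-𝐁    : ∀ {Γ a b} → (Γ ⊢ a 𝐍) ∷ (Γ ⊢ b 𝐍) ∷ [] ⟹ᴿ Γ ⊢ (a ≐ b) 𝐁
  ≐-𝐁-E  : ∀ {Γ a b} → (Γ ⊢ (a ≐ b) 𝐁) ∷ [] ⟹ᴿ Γ ⊢ (a 𝐍) ∧̇ (b 𝐍)

  𝟎-𝐍    : ∀ {Γ} → [] ⟹ᴿ Γ ⊢ 𝟎 𝐍
  𝐒-𝐍-I  : ∀ {Γ a} → (Γ ⊢ a 𝐍) ∷ [] ⟹ᴿ Γ ⊢ (𝐒 a) 𝐍
  𝐒-𝐍-E  : ∀ {Γ a} → (Γ ⊢ (𝐒 a) 𝐍) ∷ [] ⟹ᴿ Γ ⊢ a 𝐍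
  𝐒≠𝟎    : ∀ {Γ a} → (Γ ⊢ a 𝐍) ∷ [] ⟹ᴿ Γ ⊢ 𝐒 a ≠̇ 𝟎
  𝐒-≠-I  : ∀ {Γ a b} → (Γ ⊢ a ≠̇ b) ∷ [] ⟹ᴿ Γ ⊢ 𝐒 a ≠̇ 𝐒 b
  𝐒-≠-E  : ∀ {Γ a b} → (Γ ⊢ 𝐒 a ≠̇ 𝐒 b) ∷ [] ⟹ᴿ Γ ⊢ a ≠̇ b
  𝐒-inj  : ∀ {Γ a b} → (Γ ⊢ 𝐒 a ≐ 𝐒 b) ∷ [] ⟹ᴿ Γ ⊢ a ≐ b
  ⊥-E    : ∀ {Γ p} → (Γ ⊢ ⊥̇ 𝐍) ∷ [] ⟹ᴿ Γ ⊢ p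
  ind    : ∀ {Γ c a} i → All (λ γ → ¬ (i ∈fv γ)) Γ →
           (Γ ⊢ [ i ↦ 𝟎 ] c)
             ∷ (var i 𝐍 ∷ c ∷ Γ ⊢ [ i ↦ 𝐒 var i ] c)
             ∷ (Γ ⊢ a 𝐍) ∷ []
           ⟹ᴿ Γ ⊢ [ i ↦ a ] c

  ▷-expand : ∀ {Γ c c'} → c ▷ c' → (Γ ⊢ c') ∷ [] ⟹ᴿ Γ ⊢ c
  ▷-reduce : ∀ {Γ c c'} → c ▷ c' → (Γ ⊢ c) ∷ [] ⟹ᴿ Γ ⊢ c'
  ▷-¬      : ∀ {Γ c c'} → c ▷ c' → (Γ ⊢ ¬̇ c) ∷ [] ⟹ᴿ Γ ⊢ ¬̇ c'
  ▷-≐      : ∀ {Γ c c'} → c ▷ c' → (Γ ⊢ c' 𝐍) ∷ [] ⟹ᴿ Γ ⊢ c ≐ c'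
  𝓡-𝐒      : ∀ {Γ g h m} →
             (Γ ⊢ m 𝐍) ∷ (Γ ⊢ (h · m · (𝓡 · g · h · m)) 𝐍) ∷ []
             ⟹ᴿ Γ ⊢ 𝓡 · g · h · (𝐒 m) ≐ h · m · (𝓡 · g · h · m)

  𝓐-I  : ∀ {Γ f} →
         (var 0 𝐍 ∷ map ↑ Γ ⊢ ↑ f · var 0) ∷ [] ⟹ᴿ Γ ⊢ 𝓐 · f
  𝓐-E  : ∀ {Γ f a} → (Γ ⊢ 𝓐 · f) ∷ (Γ ⊢ a 𝐍) ∷ [] ⟹ᴿ Γ ⊢ f · a
  ¬𝓐-I : ∀ {Γ f a} → (Γ ⊢ ¬̇ (f · a)) ∷ (Γ ⊢ a 𝐍) ∷ [] ⟹ᴿ Γ ⊢ ¬̇ (𝓐 · f)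
  ¬𝓐-E : ∀ {Γ f c} →
         (Γ ⊢ ¬̇ (𝓐 · f))
           ∷ (var 0 𝐍 ∷ ¬̇ (↑ f · var 0) ∷ map ↑ Γ ⊢ ↑ c) ∷ []
         ⟹ᴿ Γ ⊢ c

data _⟹ᴼ_ : List Judgment → Judgment → Set where
  rga : ∀ {ps J} → ps ⟹ᴿ J → ps ⟹ᴼ J
  ATI : ∀ {Γ u} →
        (Γ ⊢ 𝓐 · (ƛ ((↑ u · var 0) 𝐁))) ∷ [] ⟹ᴼ Γ ⊢ (𝓐 · u) 𝐁

_occursIn_ : Judgment → List Judgment → Set
J occursIn π = Any (J ≋_) π

-- A proof is listed with its latest entry first, so "earlier" means "in the
-- tail".
data OGAProof : List Judgment → Set where
  []   : OGAProof []
  step : ∀ {π ps J} → OGAProof π → ps ⟹ᴼ J → All (_occursIn π) ps →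
         OGAProof (J ∷ π)

OGA-Derivable : Judgment → Set
OGA-Derivable J = ∃[ π ] (OGAProof π × J occursIn π)

-- Defined on all terms for convenience.  In every clause a closed conclusion
-- has closed premises, so on closed terms, the only ones to which it is
-- applied, this is the least relation on closed terms given by these clauses.
data _⇓_ : Term → ℕ → Set where
  ⇓𝟎  : 𝟎 ⇓ 0
  ⇓𝐒  : ∀ {t n} → t ⇓ n → 𝐒 t ⇓ suc n
  ⇓≐₁ : ∀ {t u m n} → t ⇓ m → u ⇓ n → m ≡ n → (t ≐ u) ⇓ 1
  ⇓≐₀ : ∀ {t u m n} → t ⇓ m → u ⇓ n → m ≢ n → (t ≐ u) ⇓ 0
  ⇓¬₀ : ∀ {t} → t ⇓ 1 → (¬̇ t) ⇓ 0
  ⇓¬₁ : ∀ {t} → t ⇓ 0 → (¬̇ t) ⇓ 1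
  ⇓∨ˡ : ∀ {t u} → t ⇓ 1 → (t ∨̇ u) ⇓ 1
  ⇓∨ʳ : ∀ {t u} → u ⇓ 1 → (t ∨̇ u) ⇓ 1
  ⇓∨₀ : ∀ {t u} → t ⇓ 0 → u ⇓ 0 → (t ∨̇ u) ⇓ 0
  ⇓β  : ∀ {b t n} ss → b [ t ] ·* ss ⇓ n → (ƛ b) · t ·* ss ⇓ n
  ⇓𝓡𝟎 : ∀ {g h a n} ss → a ⇓ 0 → g ·* ss ⇓ n → 𝓡 · g · h · a ·* ss ⇓ n
  ⇓𝓡𝐒 : ∀ {g h a k n} ss → a ⇓ suc k →
        h · num k · (𝓡 · g · h · num k) ·* ss ⇓ n →
        𝓡 · g · h · a ·* ss ⇓ n
  ⇓𝓐₁ : ∀ {f} → (∀ k → f · num k ⇓ 1) → 𝓐 · f ⇓ 1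
  ⇓𝓐₀ : ∀ {f} k → f · num k ⇓ 0 → 𝓐 · f ⇓ 0

-- Certified adoptable: well-formed (automatic, see Term), closed, ω-true.
CertifiedAdoptable : Term → Set
CertifiedAdoptable t = Closed t × t ⇓ 1

{-# OPTIONS --safe #-}
module Submission where

-- Replacing ∃ and ⊎ in ω-truth by their double negations would justify ATI, but
-- then 𝓐-I would need the double negation shift.  So evaluation is cut into
-- stages: Val α t n says, up to double negation, that t has value n by a
-- derivation of height bounded by the Brouwer tree α.  A derivation of Γ ⊢ c
-- yields a function F on trees such that, for every substitution σ, if σΓ holds at
-- stage α then σc holds at stage F α.  Since F α does not depend on σ, the premise
-- of 𝓐-I holds for all numerals at a single stage, and since the stages are
-- ¬¬-stable, the case distinction behind ATI is available.  Values are unique, so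
-- c and ¬̇ c never hold together.

open import Defs
open import Data.Bool using (true; false; if_then_else_)
open import Data.Empty using (⊥; ⊥-elim)
open import Data.List using (List; []; _∷_; _++_)
open import Data.List.Relation.Unary.All as All using (All; []; _∷_)
open import Data.List.Relation.Unary.All.Properties using (++⁺; map⁺; map⁻)
open import Data.List.Relation.Unary.Any using (here; there)
open import Data.Nat using (ℕ; zero; suc; _≟_)
open import Data.Nat.Properties using (suc-injective)
open import Data.Product using (∃-syntax; _×_; _,_; proj₁; proj₂)
open import Data.Sum using (_⊎_; inj₁; inj₂)
open import Function using (_∘_; id)
open import Function.Bundles using (Equivalence)
open import Relation.Binary.PropositionalEquality
  using (_≡_; _≢_; _≗_; refl; sym; trans; cong; cong₂)
  renaming (subst to transport)
open import Relation.Nullary using (¬_; Dec; yes; no; does)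
open import Relation.Nullary.Decidable
  using (decidable-stable; dec-true; dec-false; ¬¬-excluded-middle)

-- Substitution calculus

-- Agreement is asked for on the free variables only, so that the eigenvariable condition of `ind`
-- can be exploited through `sub-update-fresh`.
sub-local : ∀ {σ τ} t → (∀ i → i ∈fv t → σ i ≡ τ i) → sub σ t ≡ sub τ t
sub-local (var i) h = h i refl
sub-local ⊥̇ h = refl
sub-local 𝟎 h = refl
sub-local (𝐒 t) h = cong 𝐒_ (sub-local t h)
sub-local (t ≐ u) h =
  cong₂ _≐_ (sub-local t (λ i → h i ∘ inj₁)) (sub-local u (λ i → h i ∘ inj₂))
sub-local (¬̇ t) h = cong ¬̇_ (sub-local t h)
sub-local (t ∨̇ u) h =
  cong₂ _∨̇_ (sub-local t (λ i → h i ∘ inj₁)) (sub-local u (λ i → h i ∘ inj₂))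
sub-local (ƛ b) h =
  cong ƛ_ (sub-local b λ { zero _ → refl ; (suc i) p → cong ↑ (h i p) })
sub-local (t · u) h =
  cong₂ _·_ (sub-local t (λ i → h i ∘ inj₁)) (sub-local u (λ i → h i ∘ inj₂))
sub-local 𝓡 h = refl
sub-local 𝓐 h = refl

sub-cong : ∀ {σ τ} → σ ≗ τ → sub σ ≗ sub τ
sub-cong h t = sub-local t (λ i _ → h i)

sub-var : ∀ t → sub var t ≡ t
sub-var (var i) = refl
sub-var ⊥̇ = refl
sub-var 𝟎 = refl
sub-var (𝐒 t) = cong 𝐒_ (sub-var t)
sub-var (t ≐ u) = cong₂ _≐_ (sub-var t) (sub-var u)
sub-var (¬̇ t) = cong ¬̇_ (sub-var t)
sub-var (t ∨̇ u) = cong₂ _∨̇_ (sub-var t) (sub-var u)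
sub-var (ƛ b) =
  cong ƛ_ (trans (sub-cong (λ { zero → refl ; (suc i) → refl }) b) (sub-var b))
sub-var (t · u) = cong₂ _·_ (sub-var t) (sub-var u)
sub-var 𝓡 = refl
sub-var 𝓐 = refl

sub-ren : ∀ {σ ρ} t → sub σ (ren ρ t) ≡ sub (σ ∘ ρ) t
sub-ren (var i) = refl
sub-ren ⊥̇ = refl
sub-ren 𝟎 = refl
sub-ren (𝐒 t) = cong 𝐒_ (sub-ren t)
sub-ren (t ≐ u) = cong₂ _≐_ (sub-ren t) (sub-ren u)
sub-ren (¬̇ t) = cong ¬̇_ (sub-ren t)
sub-ren (t ∨̇ u) = cong₂ _∨̇_ (sub-ren t) (sub-ren u)
sub-ren (ƛ b) =
  cong ƛ_ (trans (sub-ren b) (sub-cong (λ { zero → refl ; (suc i) → refl }) b))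
sub-ren (t · u) = cong₂ _·_ (sub-ren t) (sub-ren u)
sub-ren 𝓡 = refl
sub-ren 𝓐 = refl

ren≡sub : ∀ {ρ} t → ren ρ t ≡ sub (var ∘ ρ) t
ren≡sub t = trans (sym (sub-var _)) (sub-ren t)

ren-ren : ∀ {ρ ρ′} t → ren ρ (ren ρ′ t) ≡ ren (ρ ∘ ρ′) t
ren-ren t = trans (ren≡sub _) (trans (sub-ren t) (sym (ren≡sub t)))

ren-sub : ∀ {ρ σ} t → ren ρ (sub σ t) ≡ sub (ren ρ ∘ σ) t
ren-sub (var i) = refl
ren-sub ⊥̇ = refl
ren-sub 𝟎 = refl
ren-sub (𝐒 t) = cong 𝐒_ (ren-sub t)
ren-sub (t ≐ u) = cong₂ _≐_ (ren-sub t) (ren-sub u)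
ren-sub (¬̇ t) = cong ¬̇_ (ren-sub t)
ren-sub (t ∨̇ u) = cong₂ _∨̇_ (ren-sub t) (ren-sub u)
ren-sub {ρ} {σ} (ƛ b) = cong ƛ_ (trans (ren-sub b) (sub-cong under b))
  where
  under : ren (ext ρ) ∘ exts σ ≗ exts (ren ρ ∘ σ)
  under zero    = refl
  under (suc i) = trans (ren-ren (σ i)) (sym (ren-ren (σ i)))
ren-sub (t · u) = cong₂ _·_ (ren-sub t) (ren-sub u)
ren-sub 𝓡 = refl
ren-sub 𝓐 = refl

sub-sub : ∀ {σ τ} t → sub σ (sub τ t) ≡ sub (sub σ ∘ τ) t
sub-sub (var i) = refl
sub-sub ⊥̇ = refl
sub-sub 𝟎 = refl
sub-sub (𝐒 t) = cong 𝐒_ (sub-sub t)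
sub-sub (t ≐ u) = cong₂ _≐_ (sub-sub t) (sub-sub u)
sub-sub (¬̇ t) = cong ¬̇_ (sub-sub t)
sub-sub (t ∨̇ u) = cong₂ _∨̇_ (sub-sub t) (sub-sub u)
sub-sub {σ} {τ} (ƛ b) = cong ƛ_ (trans (sub-sub b) (sub-cong under b))
  where
  under : sub (exts σ) ∘ exts τ ≗ exts (sub σ ∘ τ)
  under zero    = refl
  under (suc i) = trans (sub-ren (τ i)) (sym (ren-sub (τ i)))
sub-sub (t · u) = cong₂ _·_ (sub-sub t) (sub-sub u)
sub-sub 𝓡 = refl
sub-sub 𝓐 = refl

infixr 5 _▸_
_▸_ : Term → (ℕ → Term) → ℕ → Term
(t ▸ σ) zero    = t
(t ▸ σ) (suc i) = σ i

update : (ℕ → Term) → ℕ → Term → ℕ → Term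
update σ v s j = if does (j ≟ v) then s else σ j

[]≡sub-▸ : ∀ b t → b [ t ] ≡ sub (t ▸ var) b
[]≡sub-▸ b t = sub-cong (λ { zero → refl ; (suc i) → refl }) b

sub-[] : ∀ σ b t → sub σ (b [ t ]) ≡ sub (exts σ) b [ sub σ t ]
sub-[] σ b t =
  trans (cong (sub σ) ([]≡sub-▸ b t))
    (trans (sub-sub b)
      (trans (sub-cong pointwise b)
        (sym (trans ([]≡sub-▸ (sub (exts σ) b) (sub σ t)) (sub-sub b)))))
  where
  pointwise : sub σ ∘ (t ▸ var) ≗ sub (sub σ t ▸ var) ∘ exts σ
  pointwise zero    = refl
  pointwise (suc i) = sym (trans (sub-ren (σ i)) (sub-var (σ i)))

sub-↦ : ∀ σ v s t → sub σ ([ v ↦ s ] t) ≡ sub (update σ v (sub σ s)) t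
sub-↦ σ v s t = trans (sub-sub t) (sub-cong pointwise t)
  where
  pointwise : ∀ j → sub σ (if does (j ≟ v) then s else var j) ≡ update σ v (sub σ s) j
  pointwise j with does (j ≟ v)
  ... | true  = refl
  ... | false = refl

update-same : ∀ σ v s → update σ v s v ≡ s
update-same σ v s = cong (if_then s else σ v) (dec-true (v ≟ v) refl)

update-other : ∀ σ {v} s {j} → j ≢ v → update σ v s j ≡ σ j
update-other σ {v} s {j} j≢v = cong (if_then s else σ j) (dec-false (j ≟ v) j≢v)

update-update : ∀ σ v s s′ → update (update σ v s) v s′ ≗ update σ v s′
update-update σ v s s′ j with does (j ≟ v)
... | true  = refl
... | false = refl

sub-update-fresh : ∀ σ {v} s t → ¬ (v ∈fv t) → sub (update σ v s) t ≡ sub σ t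
sub-update-fresh σ s t v∉t =
  sub-local t (λ j j∈t → update-other σ s (λ { refl → v∉t j∈t }))

sub-num : ∀ σ k → sub σ (num k) ≡ num k
sub-num σ zero    = refl
sub-num σ (suc k) = cong 𝐒_ (sub-num σ k)

-- Stages of evaluation

-- Unlike `▷`, the recursor may fire on any argument whose value is given by `P`, as in `⇓`. The
-- constructor `app` plays the part of the argument lists `ss` there.
data Head (P : Term → ℕ → Set) : Term → Term → Set where
  β-head  : ∀ {b t} → Head P ((ƛ b) · t) (b [ t ])
  𝓡𝟎-head : ∀ {g h a} → P a 0 → Head P (𝓡 · g · h · a) g
  𝓡𝐒-head : ∀ {g h a k} → P a (suc k) →
            Head P (𝓡 · g · h · a) (h · num k · (𝓡 · g · h · num k))
  app     : ∀ {t t′ u} → Head P t t′ → Head P (t · u) (t′ · u)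

-- One layer of `⇓` with its recursive premises left open as `P`, so that the stages can be defined
-- by recursion on a tree.
data Eval (P : Term → ℕ → Set) : Term → ℕ → Set where
  zero : Eval P 𝟎 0
  succ : ∀ {t n} → P t n → Eval P (𝐒 t) (suc n)
  eq₁  : ∀ {t u m} → P t m → P u m → Eval P (t ≐ u) 1
  eq₀  : ∀ {t u m n} → P t m → P u n → m ≢ n → Eval P (t ≐ u) 0
  not₀ : ∀ {t} → P t 1 → Eval P (¬̇ t) 0
  not₁ : ∀ {t} → P t 0 → Eval P (¬̇ t) 1
  orˡ  : ∀ {t u} → P t 1 → Eval P (t ∨̇ u) 1
  orʳ  : ∀ {t u} → P u 1 → Eval P (t ∨̇ u) 1
  or₀  : ∀ {t u} → P t 0 → P u 0 → Eval P (t ∨̇ u) 0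
  head : ∀ {t t′ n} → Head P t t′ → P t′ n → Eval P t n
  all₁ : ∀ {f} → (∀ k → P (f · num k) 1) → Eval P (𝓐 · f) 1
  all₀ : ∀ {f} k → P (f · num k) 0 → Eval P (𝓐 · f) 0

module _ {P Q : Term → ℕ → Set} (P⊆Q : ∀ {t n} → P t n → Q t n) where

  Head-mono : ∀ {t u} → Head P t u → Head Q t u
  Head-mono β-head      = β-head
  Head-mono (𝓡𝟎-head p) = 𝓡𝟎-head (P⊆Q p)
  Head-mono (𝓡𝐒-head p) = 𝓡𝐒-head (P⊆Q p)
  Head-mono (app r)     = app (Head-mono r)

  Eval-mono : ∀ {t n} → Eval P t n → Eval Q t n
  Eval-mono zero        = zero
  Eval-mono (succ p)    = succ (P⊆Q p)
  Eval-mono (eq₁ p q)   = eq₁ (P⊆Q p) (P⊆Q q)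
  Eval-mono (eq₀ p q d) = eq₀ (P⊆Q p) (P⊆Q q) d
  Eval-mono (not₀ p)    = not₀ (P⊆Q p)
  Eval-mono (not₁ p)    = not₁ (P⊆Q p)
  Eval-mono (orˡ p)     = orˡ (P⊆Q p)
  Eval-mono (orʳ p)     = orʳ (P⊆Q p)
  Eval-mono (or₀ p q)   = or₀ (P⊆Q p) (P⊆Q q)
  Eval-mono (head r p)  = head (Head-mono r) (P⊆Q p)
  Eval-mono (all₁ p)    = all₁ (λ k → P⊆Q (p k))
  Eval-mono (all₀ k p)  = all₀ k (P⊆Q p)

data Ord : Set where
  leaf : Ord
  sup  : (ℕ → Ord) → Ord

-- Opaque so that the stage can be inferred from a hypothesis Val α t n.
opaque
  Val : Ord → Term → ℕ → Set
  Val leaf    t n = ⊥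
  Val (sup f) t n = ¬ ¬ (∃[ k ] Eval (Val (f k)) t n)

  Val-leaf : ∀ {t n} → ¬ Val leaf t n
  Val-leaf ()

  Val-sup⁻ : ∀ {f t n} → Val (sup f) t n → ¬ ¬ (∃[ k ] Eval (Val (f k)) t n)
  Val-sup⁻ p = p

  Val-sup⁺ : ∀ {f t n} k → Eval (Val (f k)) t n → Val (sup f) t n
  Val-sup⁺ k e ¬p = ¬p (k , e)

  -- Each stage is `⊥` or a negation, hence ¬¬-stable: a fact known only up to double negation may
  -- be used while proving that a term has a value.
  Val-bind : ∀ α {t n} {A : Set} → ¬ ¬ A → (A → Val α t n) → Val α t n
  Val-bind leaf    ¬¬a f = ¬¬a f
  Val-bind (sup _) ¬¬a f ¬p = ¬¬a (λ a → f a ¬p)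

infixl 1 _>>=_
_>>=_ : ∀ {α t n} {A : Set} → ¬ ¬ A → (A → Val α t n) → Val α t n
_>>=_ {α} = Val-bind α

-- The two functions descend the tree together. Inclusion of a branch inverts at that branch to
-- expose an `Eval`; inversion at `sup f` lifts the premises of the chosen branch back to `sup f`.
-- Inversion thus leaves the stage unchanged.
Val-⊆-sup : ∀ {f t n} k → Val (f k) t n → Val (sup f) t n
Val-inv : ∀ α {t n} → Val α t n → ¬ ¬ Eval (Val α) t n

Val-⊆-sup {f} k p = Val-inv (f k) p >>= Val-sup⁺ k
Val-inv leaf p = ⊥-elim (Val-leaf p)
Val-inv (sup f) p ¬e = Val-sup⁻ p λ (k , e) → ¬e (Eval-mono (Val-⊆-sup k) e)

invert : ∀ {α t n} → Val α t n → ¬ ¬ Eval (Val α) t n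
invert {α} = Val-inv α

next : Ord → Ord
next α = sup (λ _ → α)

infixl 6 _⊔_ _⊕_
_⊔_ : Ord → Ord → Ord
α ⊔ δ = sup λ { zero → α ; (suc _) → δ }

-- Ordinal addition: the left tree is grafted onto the leaves of the right one.
_⊕_ : Ord → Ord → Ord
α ⊕ leaf  = α
α ⊕ sup f = sup (λ k → α ⊕ f k)

finite : ℕ → Ord
finite zero    = leaf
finite (suc k) = next (finite k)

ω : Ord
ω = sup finite

intro : ∀ {α t n} → Eval (Val α) t n → Val (next α) t n
intro = Val-sup⁺ 0

weaken-next : ∀ {α t n} → Val α t n → Val (next α) t n
weaken-next = Val-⊆-sup 0

weaken-⊔ˡ : ∀ {α δ t n} → Val α t n → Val (α ⊔ δ) t n
weaken-⊔ˡ = Val-⊆-sup 0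

weaken-⊔ʳ : ∀ {α δ t n} → Val δ t n → Val (α ⊔ δ) t n
weaken-⊔ʳ = Val-⊆-sup 1

weaken-⊕ : ∀ {α} δ {t n} → Val α t n → Val (α ⊕ δ) t n
weaken-⊕ leaf    p = p
weaken-⊕ (sup f) p = Val-⊆-sup 0 (weaken-⊕ (f 0) p)

-- One stage serves all numerals at once, which keeps the bounds for `ind` and the quantifier rules
-- independent of the numeral.
Val-num : ∀ k → Val ω (num k) k
Val-num k = Val-sup⁺ k (eval k)
  where
  eval : ∀ k → Eval (Val (finite k)) (num k) k
  eval zero    = zero
  eval (suc k) = succ (intro (eval k))

-- Determinism

-- The shape of a term fixes its redex; only the choice between the two recursor clauses depends on
-- a value, and there `d` decides. `P` and `Q` differ so that evaluations at different stages can be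
-- compared.
Head-det : ∀ {P Q} → (∀ {a m n} → P a m → Q a n → m ≡ n) →
           ∀ {t u v} → Head P t u → Head Q t v → u ≡ v
Head-det d β-head β-head = refl
Head-det d β-head (app ())
Head-det d (𝓡𝟎-head p) (𝓡𝟎-head q) = refl
Head-det d (𝓡𝟎-head p) (𝓡𝐒-head q) with () ← d p q
Head-det d (𝓡𝟎-head p) (app (app (app ())))
Head-det d (𝓡𝐒-head p) (𝓡𝟎-head q) with () ← d p q
Head-det d (𝓡𝐒-head p) (𝓡𝐒-head q) with refl ← d p q = refl
Head-det d (𝓡𝐒-head p) (app (app (app ())))
Head-det d (app ()) β-head
Head-det d (app (app (app ()))) (𝓡𝟎-head q)
Head-det d (app (app (app ()))) (𝓡𝐒-head q)
Head-det d (app r) (app s) = cong (_· _) (Head-det d r s)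

Eval-det : ∀ {P Q} → (∀ {a m n} → P a m → Q a n → m ≡ n) →
           ∀ {t m n} → Eval P t m → Eval Q t n → m ≡ n
Eval-det d zero zero = refl
Eval-det d (succ p) (succ q) = cong suc (d p q)
Eval-det d (eq₁ p q) (eq₁ p′ q′) = refl
Eval-det d (eq₁ p q) (eq₀ p′ q′ m≢n) = ⊥-elim (m≢n (trans (sym (d p p′)) (d q q′)))
Eval-det d (eq₀ p q m≢n) (eq₁ p′ q′) = ⊥-elim (m≢n (trans (d p p′) (sym (d q q′))))
Eval-det d (eq₀ p q _) (eq₀ p′ q′ _) = refl
Eval-det d (not₀ p) (not₀ q) = refl
Eval-det d (not₀ p) (not₁ q) = sym (d p q)
Eval-det d (not₁ p) (not₀ q) = sym (d p q)
Eval-det d (not₁ p) (not₁ q) = refl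
Eval-det d (orˡ p) (orˡ q) = refl
Eval-det d (orˡ p) (orʳ q) = refl
Eval-det d (orˡ p) (or₀ q _) = d p q
Eval-det d (orʳ p) (orˡ q) = refl
Eval-det d (orʳ p) (orʳ q) = refl
Eval-det d (orʳ p) (or₀ _ q) = d p q
Eval-det d (or₀ p _) (orˡ q) = d p q
Eval-det d (or₀ _ p) (orʳ q) = d p q
Eval-det d (or₀ _ _) (or₀ _ _) = refl
Eval-det d (head r p) (head s q) with refl ← Head-det d r s = d p q
Eval-det d (head (app ()) p) (all₁ q)
Eval-det d (head (app ()) p) (all₀ k q)
Eval-det d (all₁ p) (head (app ()) q)
Eval-det d (all₀ k p) (head (app ()) q)
Eval-det d (all₁ p) (all₁ q) = refl
Eval-det d (all₁ p) (all₀ k q) = d (p k) q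
Eval-det d (all₀ k p) (all₁ q) = d p (q k)
Eval-det d (all₀ k p) (all₀ l q) = refl

-- Equality of naturals is decidable, hence stable, so both double negations can be opened. The
-- recursion is on the first tree alone; the second evaluation is inverted at its own stage.
Val-det : ∀ α {δ t m n} → Val α t m → Val δ t n → m ≡ n
Val-det leaf p q = ⊥-elim (Val-leaf p)
Val-det (sup f) {m = m} {n} p q = decidable-stable (m ≟ n) λ m≢n →
  Val-sup⁻ p λ (k , e) → invert q λ e′ → m≢n (Eval-det (Val-det (f k)) e e′)

det : ∀ {α δ t m n} → Val α t m → Val δ t n → m ≡ n
det {α} = Val-det α

-- Applied values

-- `t ⊑ u` says that `u` is `t` applied to some list of arguments.
data _⊑_ (t : Term) : Term → Set where
  here  : t ⊑ t
  there : ∀ {u s} → t ⊑ u → t ⊑ (u · s)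

-- The conclusions of all clauses of `Eval` other than `head`.
data Inert : Term → Set where
  zero : Inert 𝟎
  succ : ∀ {t} → Inert (𝐒 t)
  eq   : ∀ {t u} → Inert (t ≐ u)
  not  : ∀ {t} → Inert (¬̇ t)
  or   : ∀ {t u} → Inert (t ∨̇ u)
  all  : ∀ {f} → Inert (𝓐 · f)

inert-or-head : ∀ {P t n} → Eval P t n → Inert t ⊎ (∃[ t′ ] Head P t t′ × P t′ n)
inert-or-head zero        = inj₁ zero
inert-or-head (succ _)    = inj₁ succ
inert-or-head (eq₁ _ _)   = inj₁ eq
inert-or-head (eq₀ _ _ _) = inj₁ eq
inert-or-head (not₀ _)    = inj₁ not
inert-or-head (not₁ _)    = inj₁ not
inert-or-head (orˡ _)     = inj₁ or
inert-or-head (orʳ _)     = inj₁ or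
inert-or-head (or₀ _ _)   = inj₁ or
inert-or-head (head r p)  = inj₂ (_ , r , p)
inert-or-head (all₁ _)    = inj₁ all
inert-or-head (all₀ _ _)  = inj₁ all

-- A head step needs at the bottom of the application spine an abstraction with an argument, or `𝓡`
-- with three arguments. No initial part of such a spine is inert.
Inert-¬Head : ∀ {P t u v} → Inert t → t ⊑ u → ¬ Head P u v
Inert-¬Head () here β-head
Inert-¬Head () (there here) β-head
Inert-¬Head () here (𝓡𝟎-head _)
Inert-¬Head () (there here) (𝓡𝟎-head _)
Inert-¬Head () (there (there here)) (𝓡𝟎-head _)
Inert-¬Head () (there (there (there here))) (𝓡𝟎-head _)
Inert-¬Head () here (𝓡𝐒-head _)
Inert-¬Head () (there here) (𝓡𝐒-head _)
Inert-¬Head () (there (there here)) (𝓡𝐒-head _)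
Inert-¬Head () (there (there (there here))) (𝓡𝐒-head _)
Inert-¬Head all here (app ())
Inert-¬Head i (there t⊑u) (app r) = Inert-¬Head i t⊑u r

Head-⊑ : ∀ {P t t′ u} → Head P t t′ → t ⊑ u → ∃[ u′ ] Head P u u′ × t′ ⊑ u′
Head-⊑ r here = _ , r , here
Head-⊑ r (there t⊑u) with _ , s , t′⊑u′ ← Head-⊑ r t⊑u = _ , app s , there t′⊑u′

¬Val-𝓐 : ∀ {α n} → ¬ Val α 𝓐 n
¬Val-𝓐 p = invert p λ { (head () _) }

-- A number is not a function. The head steps of `t` are also head steps of `u · s`; following them
-- down the stage of `t` ends at an inert term, where `u · s` is stuck. This disposes of
-- replacements in function position in `Val-~`.
¬Val-applied : ∀ α {δ t m u s n} → Val α t m → t ⊑ u → ¬ Val δ (u · s) n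
¬Val-applied leaf p t⊑u q = Val-leaf p
¬Val-applied (sup f) {δ} {u = u} {s} p t⊑u q =
  Val-sup⁻ p λ (k , e) → invert q λ e′ → clash k (inert-or-head e) p t⊑u e′
  where
  clash : ∀ k {t m n} → Inert t ⊎ (∃[ t′ ] Head (Val (f k)) t t′ × Val (f k) t′ m) →
          Val (sup f) t m → t ⊑ u → ¬ Eval (Val δ) (u · s) n
  clash k (inj₁ i) p t⊑u (head r q) = Inert-¬Head i (there t⊑u) r
  -- The step of `t`, carried up the spine, must be the step that evaluates `u · s`, so the reducts
  -- form the same situation at a smaller stage.
  clash k (inj₂ (_ , r , p′)) p t⊑u (head r′ q)
    with _ , r″ , t′⊑u′ ← Head-⊑ r t⊑u
    with refl ← Head-det det (app r″) r′ = ¬Val-applied (f k) p′ t′⊑u′ q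
  -- Here `u` is `𝓐`, which forces `t` to be `𝓐` as well, a term without value.
  clash k _ p here (all₁ _)   = ¬Val-𝓐 p
  clash k _ p here (all₀ _ _) = ¬Val-𝓐 p

-- Substitution in evaluations

module _ {P : Term → ℕ → Set} (σ : ℕ → Term) (P-sub : ∀ {t n} → P t n → P (sub σ t) n)
  where

  Head-sub : ∀ {t u} → Head P t u → Head P (sub σ t) (sub σ u)
  Head-sub (β-head {b} {t}) rewrite sub-[] σ b t = β-head
  Head-sub (𝓡𝟎-head p) = 𝓡𝟎-head (P-sub p)
  Head-sub (𝓡𝐒-head {k = k} p) rewrite sub-num σ k = 𝓡𝐒-head (P-sub p)
  Head-sub (app r) = app (Head-sub r)

  Eval-sub : ∀ {t n} → Eval P t n → Eval P (sub σ t) n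
  Eval-sub zero        = zero
  Eval-sub (succ p)    = succ (P-sub p)
  Eval-sub (eq₁ p q)   = eq₁ (P-sub p) (P-sub q)
  Eval-sub (eq₀ p q d) = eq₀ (P-sub p) (P-sub q) d
  Eval-sub (not₀ p)    = not₀ (P-sub p)
  Eval-sub (not₁ p)    = not₁ (P-sub p)
  Eval-sub (orˡ p)     = orˡ (P-sub p)
  Eval-sub (orʳ p)     = orʳ (P-sub p)
  Eval-sub (or₀ p q)   = or₀ (P-sub p) (P-sub q)
  Eval-sub (head r p)  = head (Head-sub r) (P-sub p)
  Eval-sub (all₁ {f} p) =
    all₁ (λ k → transport (λ s → P (sub σ f · s) 1) (sub-num σ k) (P-sub (p k)))
  Eval-sub (all₀ {f} k p) =
    all₀ k (transport (λ s → P (sub σ f · s) 0) (sub-num σ k) (P-sub p))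

-- No clause of evaluation inspects a variable, so an evaluation of an open term can be instantiated
-- clause by clause, at the same stage.
Val-sub : ∀ α {σ t n} → Val α t n → Val α (sub σ t) n
Val-sub leaf p = ⊥-elim (Val-leaf p)
Val-sub (sup f) {σ} p = Val-sup⁻ p >>= λ (k , e) → Val-sup⁺ k (Eval-sub σ (Val-sub (f k)) e)

Val-ren : ∀ {α ρ t n} → Val α t n → Val α (ren ρ t) n
Val-ren {α} {t = t} p = transport (λ u → Val α u _) (sym (ren≡sub t)) (Val-sub α p)

-- Extensionality

module _ {γ : Ord} where

  infix 4 _~_
  -- The congruence generated by exchanging subterms that share a value at stage `γ`. The exchange
  -- may happen under `ƛ`, because values survive renaming and substitution.
  data _~_ : Term → Term → Set where
    val  : ∀ {t u m} → Val γ t m → Val γ u m → t ~ u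
    var  : ∀ {i} → var i ~ var i
    bot  : ⊥̇ ~ ⊥̇
    zero : 𝟎 ~ 𝟎
    succ : ∀ {t t′} → t ~ t′ → 𝐒 t ~ 𝐒 t′
    eq   : ∀ {t t′ u u′} → t ~ t′ → u ~ u′ → t ≐ u ~ t′ ≐ u′
    not  : ∀ {t t′} → t ~ t′ → ¬̇ t ~ ¬̇ t′
    or   : ∀ {t t′ u u′} → t ~ t′ → u ~ u′ → t ∨̇ u ~ t′ ∨̇ u′
    lam  : ∀ {b b′} → b ~ b′ → ƛ b ~ ƛ b′
    _·_  : ∀ {t t′ u u′} → t ~ t′ → u ~ u′ → t · u ~ t′ · u′
    rec  : 𝓡 ~ 𝓡
    all  : 𝓐 ~ 𝓐

  ~-refl : ∀ t → t ~ t
  ~-refl (var i) = var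
  ~-refl ⊥̇ = bot
  ~-refl 𝟎 = zero
  ~-refl (𝐒 t) = succ (~-refl t)
  ~-refl (t ≐ u) = eq (~-refl t) (~-refl u)
  ~-refl (¬̇ t) = not (~-refl t)
  ~-refl (t ∨̇ u) = or (~-refl t) (~-refl u)
  ~-refl (ƛ b) = lam (~-refl b)
  ~-refl (t · u) = ~-refl t · ~-refl u
  ~-refl 𝓡 = rec
  ~-refl 𝓐 = all

  ~-ren : ∀ {ρ t u} → t ~ u → ren ρ t ~ ren ρ u
  ~-ren (val p q) = val (Val-ren p) (Val-ren q)
  ~-ren var = var
  ~-ren bot = bot
  ~-ren zero = zero
  ~-ren (succ r) = succ (~-ren r)
  ~-ren (eq r s) = eq (~-ren r) (~-ren s)
  ~-ren (not r) = not (~-ren r)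
  ~-ren (or r s) = or (~-ren r) (~-ren s)
  ~-ren (lam r) = lam (~-ren r)
  ~-ren (r · s) = ~-ren r · ~-ren s
  ~-ren rec = rec
  ~-ren all = all

  ~-exts : ∀ {σ τ} → (∀ i → σ i ~ τ i) → ∀ i → exts σ i ~ exts τ i
  ~-exts h zero    = var
  ~-exts h (suc i) = ~-ren (h i)

  ~-sub : ∀ {σ τ t u} → (∀ i → σ i ~ τ i) → t ~ u → sub σ t ~ sub τ u
  ~-sub h (val p q) = val (Val-sub γ p) (Val-sub γ q)
  ~-sub h (var {i}) = h i
  ~-sub h bot = bot
  ~-sub h zero = zero
  ~-sub h (succ r) = succ (~-sub h r)
  ~-sub h (eq r s) = eq (~-sub h r) (~-sub h s)
  ~-sub h (not r) = not (~-sub h r)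
  ~-sub h (or r s) = or (~-sub h r) (~-sub h s)
  ~-sub h (lam r) = lam (~-sub (~-exts h) r)
  ~-sub h (r · s) = ~-sub h r · ~-sub h s
  ~-sub h rec = rec
  ~-sub h all = all

  ~-update : ∀ {σ v s s′} → s ~ s′ → ∀ i → update σ v s i ~ update σ v s′ i
  ~-update {σ} {v} r i with does (i ≟ v)
  ... | true  = r
  ... | false = ~-refl (σ i)

  Head-~ : ∀ {P Q : Term → ℕ → Set} → (∀ {t u n} → P t n → t ~ u → Q u n) →
           ∀ {t s t′ u s′} → Head P (t · s) t′ → t ~ u → s ~ s′ →
           (∃[ u′ ] Head Q (u · s′) u′ × t′ ~ u′) ⊎ (∃[ v ] ∃[ m ] v ⊑ t × Val γ v m)
  Head-~ P~Q β-head (val p _) s = inj₂ (_ , _ , here , p)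
  Head-~ P~Q β-head (lam r) s =
    inj₁ (_ , β-head , ~-sub (λ { zero → s ; (suc i) → var }) r)
  Head-~ P~Q (𝓡𝟎-head _) (val p _) s = inj₂ (_ , _ , here , p)
  Head-~ P~Q (𝓡𝟎-head x) (val p _ · h) a = inj₂ (_ , _ , there here , p)
  Head-~ P~Q (𝓡𝟎-head x) (val p _ · g · h) a = inj₂ (_ , _ , there (there here) , p)
  Head-~ P~Q (𝓡𝟎-head x) (rec · g · h) a = inj₁ (_ , 𝓡𝟎-head (P~Q x a) , g)
  Head-~ P~Q (𝓡𝐒-head _) (val p _) s = inj₂ (_ , _ , here , p)
  Head-~ P~Q (𝓡𝐒-head x) (val p _ · h) a = inj₂ (_ , _ , there here , p)
  Head-~ P~Q (𝓡𝐒-head x) (val p _ · g · h) a = inj₂ (_ , _ , there (there here) , p)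
  Head-~ P~Q (𝓡𝐒-head {k = k} x) (rec · g · h) a =
    inj₁ (_ , 𝓡𝐒-head (P~Q x a) , h · ~-refl (num k) · (rec · g · h · ~-refl (num k)))
  Head-~ P~Q (app _) (val p _) s = inj₂ (_ , _ , here , p)
  Head-~ P~Q (app h) (r · r′) s with Head-~ P~Q h r r′
  ... | inj₁ (_ , h′ , t′~u′) = inj₁ (_ , app h′ , t′~u′ · s)
  ... | inj₂ (_ , _ , v⊑t , p) = inj₂ (_ , _ , there v⊑t , p)

  -- The evaluation of `t` is replayed on `u` by recursion on `α`. Where an exchanged subterm is
  -- met, its evaluation at stage `γ` is plugged in; having `γ` below every leaf of `α` makes room
  -- for it at any depth.
  Val-~ : ∀ α {t u n} → Val α t n → t ~ u → Val (γ ⊕ α) u n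
  Val-~ leaf p _ = ⊥-elim (Val-leaf p)
  Val-~ (sup f) p r = Val-sup⁻ p >>= λ (k , e) → replace k e r
    where
    contract : ∀ k {t s t′ u s′ n} → Head (Val (f k)) (t · s) t′ → Val (f k) t′ n →
               t ~ u → s ~ s′ → Val (γ ⊕ sup f) (u · s′) n
    contract k h p r s with Head-~ (Val-~ (f k)) h r s
    ... | inj₁ (_ , h′ , r′) = Val-sup⁺ k (head h′ (Val-~ (f k) p r′))
    -- Something with a value would be applied to arguments inside a term that itself has a value.
    ... | inj₂ (_ , _ , v⊑t , q) = ⊥-elim (¬Val-applied γ q v⊑t (intro (head h p)))

    replace : ∀ k {t u n} → Eval (Val (f k)) t n → t ~ u → Val (γ ⊕ sup f) u n
    replace k (head h@β-head p) (r · s) = contract k h p r s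
    replace k (head h@(𝓡𝟎-head _) p) (r · s) = contract k h p r s
    replace k (head h@(𝓡𝐒-head _) p) (r · s) = contract k h p r s
    replace k (head h@(app _) p) (r · s) = contract k h p r s
    replace k zero zero = Val-sup⁺ k zero
    replace k (succ p) (succ r) = Val-sup⁺ k (succ (Val-~ (f k) p r))
    replace k (eq₁ p q) (eq r s) = Val-sup⁺ k (eq₁ (Val-~ (f k) p r) (Val-~ (f k) q s))
    replace k (eq₀ p q d) (eq r s) = Val-sup⁺ k (eq₀ (Val-~ (f k) p r) (Val-~ (f k) q s) d)
    replace k (not₀ p) (not r) = Val-sup⁺ k (not₀ (Val-~ (f k) p r))
    replace k (not₁ p) (not r) = Val-sup⁺ k (not₁ (Val-~ (f k) p r))
    replace k (orˡ p) (or r s) = Val-sup⁺ k (orˡ (Val-~ (f k) p r))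
    replace k (orʳ p) (or r s) = Val-sup⁺ k (orʳ (Val-~ (f k) p s))
    replace k (or₀ p q) (or r s) = Val-sup⁺ k (or₀ (Val-~ (f k) p r) (Val-~ (f k) q s))
    replace k (all₁ p) (val q _ · r) = ⊥-elim (¬Val-𝓐 q)
    replace k (all₁ p) (all · r) =
      Val-sup⁺ k (all₁ (λ l → Val-~ (f k) (p l) (r · ~-refl (num l))))
    replace k (all₀ l p) (val q _ · r) = ⊥-elim (¬Val-𝓐 q)
    replace k (all₀ l p) (all · r) =
      Val-sup⁺ k (all₀ l (Val-~ (f k) p (r · ~-refl (num l))))
    -- The whole term was exchanged: determinism identifies `n` with the shared value, and `u`
    -- already has it at stage `γ`.
    replace k e (val q q′) with refl ← det (intro e) q = weaken-⊕ (sup f) q′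

-- Inversion of values

≐-inv : ∀ {α t u} → Val α (t ≐ u) 1 → ¬ ¬ (∃[ m ] Val α t m × Val α u m)
≐-inv p ¬q = invert p λ { (eq₁ q r) → ¬q (_ , q , r) ; (head () _) }

≠-inv : ∀ {α t u} → Val α (t ≠̇ u) 1 →
        ¬ ¬ (∃[ m ] ∃[ n ] m ≢ n × Val α t m × Val α u n)
≠-inv p ¬q = invert p λ
  { (not₁ p′) → invert p′ λ { (eq₀ q r m≢n) → ¬q (_ , _ , m≢n , q , r) ; (head () _) }
  ; (head () _) }

𝐒-inv : ∀ {α t n} → Val α (𝐒 t) n → ¬ ¬ (∃[ m ] n ≡ suc m × Val α t m)
𝐒-inv p ¬q = invert p λ { (succ q) → ¬q (_ , refl , q) ; (head () _) }

⊥̇-inv : ∀ {α n} → ¬ Val α ⊥̇ n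
⊥̇-inv p = invert p λ { (head () _) }

¬-inv₁ : ∀ {α t} → Val α (¬̇ t) 1 → Val α t 0
¬-inv₁ p = invert p >>= λ { (not₁ q) → q ; (head () _) }

¬-inv₀ : ∀ {α t} → Val α (¬̇ t) 0 → Val α t 1
¬-inv₀ p = invert p >>= λ { (not₀ q) → q ; (head () _) }

∨-inv₁ : ∀ {α t u} → Val α (t ∨̇ u) 1 → ¬ ¬ (Val α t 1 ⊎ Val α u 1)
∨-inv₁ p ¬q = invert p λ { (orˡ q) → ¬q (inj₁ q) ; (orʳ q) → ¬q (inj₂ q) ; (head () _) }

∨-inv₀ˡ : ∀ {α t u} → Val α (t ∨̇ u) 0 → Val α t 0
∨-inv₀ˡ p = invert p >>= λ { (or₀ q _) → q ; (head () _) }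

∨-inv₀ʳ : ∀ {α t u} → Val α (t ∨̇ u) 0 → Val α u 0
∨-inv₀ʳ p = invert p >>= λ { (or₀ _ q) → q ; (head () _) }

𝓐-inv₁ : ∀ {α f} → Val α (𝓐 · f) 1 → ∀ k → Val α (f · num k) 1
𝓐-inv₁ p k = invert p >>= λ { (all₁ q) → q k ; (head (app ()) _) }

𝓐-inv₀ : ∀ {α f} → Val α (𝓐 · f) 0 → ¬ ¬ (∃[ k ] Val α (f · num k) 0)
𝓐-inv₀ p ¬q = invert p λ { (all₀ k q) → ¬q (k , q) ; (head (app ()) _) }

-- A term with a head step can get its value from the clause `head` only, and determinism identifies
-- the two reducts, even if the recursor argument was evaluated at another stage.
Head-inv : ∀ {P α t t′ n} → (∀ {a m l} → P a m → Val α a l → m ≡ l) →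
           Head P t t′ → Val α t n → Val α t′ n
Head-inv {α = α} d h p = invert p >>= reduct h
  where
  reduct : ∀ {t t′ n} → Head _ t t′ → Eval (Val α) t n → Val α t′ n
  reduct h@β-head (head h′ q) with refl ← Head-det d h h′ = q
  reduct h@(𝓡𝟎-head _) (head h′ q) with refl ← Head-det d h h′ = q
  reduct h@(𝓡𝐒-head _) (head h′ q) with refl ← Head-det d h h′ = q
  reduct h@(app _) (head h′ q) with refl ← Head-det d h h′ = q
  reduct (app ()) (all₁ _)
  reduct (app ()) (all₀ _ _)

≐-intro : ∀ {α t u m} → Val α t m → Val α u m → Val (next α) (t ≐ u) 1
≐-intro p q = intro (eq₁ p q)

Val-⊔ω-num : ∀ {α} k → Val (α ⊔ ω) (num k) k
Val-⊔ω-num k = weaken-⊔ʳ (Val-num k)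

-- The recursor rules of `▷` fire on literal numerals, so stage `ω` covers every head step.
▷⇒Head : ∀ σ {c c′} → c ▷ c′ → Head (Val ω) (sub σ c) (sub σ c′)
▷⇒Head σ r = Head-sub σ (Val-sub ω) (convert r)
  where
  convert : ∀ {c c′} → c ▷ c′ → Head (Val ω) c c′
  convert β       = β-head
  convert 𝓡𝟎      = 𝓡𝟎-head (Val-num 0)
  convert (𝓡𝐒 n)  = 𝓡𝐒-head (Val-num (suc n))
  convert (app r) = app (convert r)

-- Soundness

Holds : Ord → (ℕ → Term) → Term → Set
Holds α σ t = Val α (sub σ t) 1

infix 2 _⊨_
record _⊨_ (Γ : Context) (c : Term) : Set where
  constructor _,_
  field
    bound : Ord → Ord
    sound : ∀ α σ → All (Holds α σ) Γ → Holds (bound α) σ c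

Valid : Judgment → Set
Valid (Γ ⊢ c) = Γ ⊨ c

Holds-≡ : ∀ {α t u n} → t ≡ u → Val α t n → Val α u n
Holds-≡ refl p = p

Holds-↑ : ∀ {α σ} s t → Holds α σ t → Holds α (s ▸ σ) (↑ t)
Holds-↑ s t = Holds-≡ (sym (sub-ren t))

Holds-↦ : ∀ {α σ} v s t → Holds α σ ([ v ↦ s ] t) → Holds α (update σ v (sub σ s)) t
Holds-↦ {σ = σ} v s t = Holds-≡ (sub-↦ σ v s t)

Holds-↦⁻ : ∀ {α σ} v s t → Holds α (update σ v (sub σ s)) t → Holds α σ ([ v ↦ s ] t)
Holds-↦⁻ {σ = σ} v s t = Holds-≡ (sym (sub-↦ σ v s t))

infer₁ : ∀ {Γ a c} (G : Ord → Ord) → (∀ {α} σ → Holds α σ a → Holds (G α) σ c) →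
         Γ ⊨ a → Γ ⊨ c
infer₁ G f (F , v) = G ∘ F , λ α σ Γ✓ → f σ (v α σ Γ✓)

infer₂ : ∀ {Γ a b c} (G : Ord → Ord) → (∀ {α} σ → Holds α σ a → Holds α σ b → Holds (G α) σ c) →
         Γ ⊨ a → Γ ⊨ b → Γ ⊨ c
infer₂ G f (F , v) (F′ , v′) =
  (λ α → G (F α ⊔ F′ α)) ,
  λ α σ Γ✓ → f σ (weaken-⊔ˡ (v α σ Γ✓)) (weaken-⊔ʳ (v′ α σ Γ✓))

-- Ordinary induction on `k` establishes `c` at every numeral, iterating the bound `G` of the step
-- premise. Since `a` has some value `m`, extensionality then exchanges `num m` for `a`.
sound-ind : ∀ {Γ c a} i → All (λ γ → ¬ (i ∈fv γ)) Γ →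
            Γ ⊨ [ i ↦ 𝟎 ] c → var i 𝐍 ∷ c ∷ Γ ⊨ [ i ↦ 𝐒 var i ] c →
            Γ ⊨ a 𝐍 → Γ ⊨ [ i ↦ a ] c
sound-ind {Γ} {c} {a} i fresh (F , base) (G , inductive-step) (H , total) = bound , sound
  where
  hypotheses : Ord → Ord → Ord
  -- `δ` accommodates `c`, `α` the context and `ω` the numeral; `next` accounts for the equation
  -- `var i 𝐍`.
  hypotheses α δ = next (δ ⊔ α ⊔ ω)

  stage : Ord → ℕ → Ord
  stage α zero    = F α
  stage α (suc k) = G (hypotheses α (stage α k))

  bound : Ord → Ord
  -- The value of `a` depends on the substitution, so the supremum runs over all possible values.
  -- The summand `H α ⊔ ω` is the stage at which `a` and its numeral share their value.
  bound α = sup (λ k → H α ⊔ ω ⊕ stage α k)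

  numerals : ∀ α σ → All (Holds α σ) Γ → ∀ k → Holds (stage α k) (update σ i (num k)) c
  numerals α σ Γ✓ zero = Holds-↦ i 𝟎 c (base α σ Γ✓)
  numerals α σ Γ✓ (suc k) =
    Holds-≡ (sub-cong successor c)
      (Holds-↦ i (𝐒 var i) c
        (inductive-step _ σₖ (number ∷ weaken-next (weaken-⊔ˡ (weaken-⊔ˡ (numerals α σ Γ✓ k))) ∷ Γ✓ₖ)))
    where
    σₖ = update σ i (num k)

    number : Holds (hypotheses α (stage α k)) σₖ (var i 𝐍)
    number = Holds-≡ (cong _𝐍 (sym (update-same σ i (num k))))
               (≐-intro (Val-⊔ω-num k) (Val-⊔ω-num k))

    Γ✓ₖ : All (Holds (hypotheses α (stage α k)) σₖ) Γ
    Γ✓ₖ = All.map (λ {t} (i∉t , p) → Holds-≡ (sym (sub-update-fresh σ (num k) t i∉t))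
                     (weaken-next (weaken-⊔ˡ (weaken-⊔ʳ p))))
                  (All.zip (fresh , Γ✓))

    successor : update σₖ i (𝐒 σₖ i) ≗ update σ i (num (suc k))
    successor j rewrite update-same σ i (num k) =
      update-update σ i (num k) (𝐒 num k) j

  sound : ∀ α σ → All (Holds α σ) Γ → Holds (bound α) σ ([ i ↦ a ] c)
  sound α σ Γ✓ = ≐-inv (total α σ Γ✓) >>= λ (m , p , _) →
    Holds-↦⁻ i a c (Val-⊆-sup m
      (Val-~ (stage α m) (numerals α σ Γ✓ m)
        (~-sub (~-update (val (Val-⊔ω-num m) (weaken-⊔ˡ p))) (~-refl c))))

-- Excluded middle is applied to one proposition: some numeral instance of `u` has value 0 at stage
-- `α`. If it fails, the premise leaves value 1 for every instance at this same stage, as inversion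
-- and β-reduction do not raise it.
sound-ATI : ∀ {Γ u} → Γ ⊨ 𝓐 · (ƛ ((↑ u · var 0) 𝐁)) → Γ ⊨ (𝓐 · u) 𝐁
sound-ATI {u = u} = infer₁ (next ∘ next ∘ next) λ {α} σ p →
  ¬¬-excluded-middle {A = ∃[ k ] Val α (sub σ u · num k) 0} >>= λ
    { (yes (k , q)) → intro (orʳ (intro (not₁ (intro (all₀ k q)))))
    ; (no none) → intro (orˡ (weaken-next (intro (all₁ λ k → decided σ p k >>= λ
        { (inj₁ q) → q
        ; (inj₂ q) → ⊥-elim (none (k , ¬-inv₁ q)) }))))
    }
  where
  instantiate : ∀ σ k → sub (exts σ) ((↑ u · var 0) 𝐁) [ num k ] ≡ (sub σ u · num k) 𝐁
  instantiate σ k =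
    trans ([]≡sub-▸ (sub (exts σ) ((↑ u · var 0) 𝐁)) (num k))
      (cong (λ t → (t · num k) 𝐁)
        (trans (sub-sub (↑ u)) (trans (sub-ren u)
          (sub-cong (λ i → trans (sub-ren (σ i)) (sub-var (σ i))) u))))

  decided : ∀ {α} σ → Holds α σ (𝓐 · (ƛ ((↑ u · var 0) 𝐁))) → ∀ k →
            ¬ ¬ (Val α (sub σ u · num k) 1 ⊎ Val α (¬̇ (sub σ u · num k)) 1)
  decided {α} σ p k =
    ∨-inv₁ (Holds-≡ (instantiate σ k) (Head-inv {P = Val α} det β-head (𝓐-inv₁ p k)))

soundᴿ : ∀ {ps J} → ps ⟹ᴿ J → All Valid ps → Valid J
soundᴿ hyp [] = id , λ { α σ (p ∷ _) → p }
soundᴿ weaken ((F , v) ∷ []) = F , λ { α σ (_ ∷ Γ✓) → v α σ Γ✓ }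
soundᴿ cut ((F , v) ∷ (G , w) ∷ []) =
  -- The second premise wants all its hypotheses at one stage, so the context is raised to meet `a`.
  (λ α → G (α ⊔ F α)) ,
  λ α σ Γ✓ → w _ σ (weaken-⊔ʳ (v α σ Γ✓) ∷ All.map weaken-⊔ˡ Γ✓)
soundᴿ (subst {Γ} {c} v s) ((F , w) ∷ []) =
  -- The premise is used at the updated substitution `update σ v (sub σ s)`.
  F , λ α σ Γ✓ → Holds-↦⁻ v s c (w α _ (All.map (λ {t} → Holds-↦ v s t) (map⁻ Γ✓)))
soundᴿ true-I (v ∷ []) =
  infer₁ (λ α → next (α ⊔ ω)) (λ σ p → ≐-intro (weaken-⊔ˡ p) (Val-⊔ω-num 1)) v
soundᴿ true-E (v ∷ []) =
  infer₁ id (λ σ p → ≐-inv p >>= λ (m , q , r) →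
    transport (Val _ _) (det r (Val-num 1)) q) v
soundᴿ false-I (v ∷ []) =
  infer₁ (λ α → next (α ⊔ ω))
    (λ σ p → ≐-intro (weaken-⊔ˡ (¬-inv₁ p)) (Val-⊔ω-num 0)) v
soundᴿ false-E (v ∷ []) =
  infer₁ next (λ σ p → ≐-inv p >>= λ (m , q , r) →
    intro (not₁ (transport (Val _ _) (det r (Val-num 0)) q))) v
soundᴿ ¬-E (v ∷ w ∷ []) =
  infer₂ id (λ σ p q → ⊥-elim (0≢1 (det (¬-inv₁ p) q))) v w
  where
  0≢1 : 0 ≢ 1
  0≢1 ()
soundᴿ ¬¬-I (v ∷ []) = infer₁ (next ∘ next) (λ σ p → intro (not₁ (intro (not₀ p)))) v
soundᴿ ¬¬-E (v ∷ []) = infer₁ id (λ σ p → ¬-inv₀ (¬-inv₁ p)) v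
soundᴿ ∨-I₁ (v ∷ []) = infer₁ next (λ σ p → intro (orˡ p)) v
soundᴿ ∨-I₂ (v ∷ []) = infer₁ next (λ σ p → intro (orʳ p)) v
soundᴿ ¬∨-I (v ∷ w ∷ []) =
  infer₂ (next ∘ next) (λ σ p q → intro (not₁ (intro (or₀ (¬-inv₁ p) (¬-inv₁ q))))) v w
soundᴿ ∨-E ((F , v) ∷ (G , w) ∷ (H , x) ∷ []) =
  -- Which disjunct holds may vary with `σ`, so the bound covers both branches.
  (λ α → G (α ⊔ F α) ⊔ H (α ⊔ F α)) ,
  λ α σ Γ✓ → ∨-inv₁ (v α σ Γ✓) >>= λ
    { (inj₁ p) → weaken-⊔ˡ (w _ σ (weaken-⊔ʳ p ∷ All.map weaken-⊔ˡ Γ✓))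
    ; (inj₂ p) → weaken-⊔ʳ (x _ σ (weaken-⊔ʳ p ∷ All.map weaken-⊔ˡ Γ✓)) }
soundᴿ ¬∨-E₁ (v ∷ []) = infer₁ next (λ σ p → intro (not₁ (∨-inv₀ˡ (¬-inv₁ p)))) v
soundᴿ ¬∨-E₂ (v ∷ []) = infer₁ next (λ σ p → intro (not₁ (∨-inv₀ʳ (¬-inv₁ p)))) v
soundᴿ 𝐍→≐ (v ∷ []) = v
soundᴿ ≐→𝐍 (v ∷ []) = v
soundᴿ ≐-sym (v ∷ []) =
  infer₁ next (λ σ p → ≐-inv p >>= λ (m , q , r) → ≐-intro r q) v
soundᴿ (≐-subst {a = a} {b} v p) (w ∷ x ∷ []) =
  infer₂ (λ α → α ⊕ α) (λ {α} σ e q → ≐-inv e >>= λ (m , r , s) →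
    Holds-↦⁻ v b p (Val-~ α (Holds-↦ v a p q) (~-sub (~-update (val r s)) (~-refl p)))) w x
soundᴿ ≠-sym (v ∷ []) =
  infer₁ (next ∘ next) (λ σ p → ≠-inv p >>= λ (m , n , m≢n , q , r) →
    intro (not₁ (intro (eq₀ r q (m≢n ∘ sym))))) v
soundᴿ ≐-𝐁 (v ∷ w ∷ []) =
  infer₂ (next ∘ next ∘ next) (λ σ p q → ≐-inv p >>= λ (m , r , _) →
    ≐-inv q >>= λ (n , s , _) → decide r s (m ≟ n)) v w
  where
  decide : ∀ {α t u m n} → Val α t m → Val α u n → Dec (m ≡ n) →
           Val (next (next (next α))) ((t ≐ u) 𝐁) 1
  decide r s (yes refl) = intro (orˡ (weaken-next (≐-intro r s)))
  decide r s (no m≢n)   = intro (orʳ (intro (not₁ (intro (eq₀ r s m≢n)))))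
soundᴿ ≐-𝐁-E (v ∷ []) =
  infer₁ (next ∘ next ∘ next ∘ next) (λ σ p → ∨-inv₁ p >>= λ
    { (inj₁ q) → ≐-inv q >>= λ (m , r , s) → both r s
    ; (inj₂ q) → ≠-inv q >>= λ (m , n , _ , r , s) → both r s }) v
  where
  both : ∀ {α t u m n} → Val α t m → Val α u n →
         Val (next (next (next (next α)))) ((t 𝐍) ∧̇ (u 𝐍)) 1
  both r s = intro (not₁ (intro (or₀ (intro (not₀ (≐-intro r r)))
                                     (intro (not₀ (≐-intro s s))))))
soundᴿ 𝟎-𝐍 [] = (λ _ → next ω) , λ α σ Γ✓ → ≐-intro (Val-num 0) (Val-num 0)
soundᴿ 𝐒-𝐍-I (v ∷ []) =
  infer₁ (next ∘ next) (λ σ p → ≐-inv p >>= λ (m , q , _) →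
    ≐-intro (intro (succ q)) (intro (succ q))) v
soundᴿ 𝐒-𝐍-E (v ∷ []) =
  infer₁ next (λ σ p → ≐-inv p >>= λ (m , q , _) → 𝐒-inv q >>= λ (_ , _ , r) →
    ≐-intro r r) v
soundᴿ 𝐒≠𝟎 (v ∷ []) =
  infer₁ (λ α → next (next (next α ⊔ ω))) (λ σ p → ≐-inv p >>= λ (m , q , _) →
    intro (not₁ (intro (eq₀ (weaken-⊔ˡ (intro (succ q))) (Val-⊔ω-num 0) λ ())))) v
soundᴿ 𝐒-≠-I (v ∷ []) =
  infer₁ (next ∘ next ∘ next) (λ σ p → ≠-inv p >>= λ (m , n , m≢n , q , r) →
    intro (not₁ (intro (eq₀ (intro (succ q)) (intro (succ r)) (m≢n ∘ suc-injective))))) v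
soundᴿ 𝐒-≠-E (v ∷ []) =
  infer₁ (next ∘ next) (λ σ p → ≠-inv p >>= λ (_ , _ , m≢n , q , r) →
    𝐒-inv q >>= λ { (_ , refl , q′) → 𝐒-inv r >>= λ { (_ , refl , r′) →
      intro (not₁ (intro (eq₀ q′ r′ (m≢n ∘ cong suc)))) } }) v
soundᴿ 𝐒-inj (v ∷ []) =
  infer₁ next (λ σ p → ≐-inv p >>= λ (_ , q , r) →
    𝐒-inv q >>= λ { (_ , refl , q′) → 𝐒-inv r >>= λ { (_ , refl , r′) →
      ≐-intro q′ r′ } }) v
soundᴿ ⊥-E (v ∷ []) =
  infer₁ id (λ σ p → ≐-inv p >>= λ (_ , q , _) → ⊥-elim (⊥̇-inv q)) v
soundᴿ (ind {c = c} {a} i fresh) (v ∷ w ∷ x ∷ []) = sound-ind {c = c} {a} i fresh v w x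
soundᴿ (▷-expand r) (v ∷ []) =
  infer₁ (λ α → next (α ⊔ ω)) (λ σ p →
    intro (head (Head-mono weaken-⊔ʳ (▷⇒Head σ r)) (weaken-⊔ˡ p))) v
soundᴿ (▷-reduce r) (v ∷ []) = infer₁ id (λ σ → Head-inv det (▷⇒Head σ r)) v
soundᴿ (▷-¬ r) (v ∷ []) =
  infer₁ next (λ σ p → intro (not₁ (Head-inv det (▷⇒Head σ r) (¬-inv₁ p)))) v
soundᴿ (▷-≐ r) (v ∷ []) =
  infer₁ (λ α → next (next (α ⊔ ω))) (λ σ p → ≐-inv p >>= λ (_ , q , _) →
    ≐-intro (intro (head (Head-mono weaken-⊔ʳ (▷⇒Head σ r)) (weaken-⊔ˡ q)))
            (weaken-next (weaken-⊔ˡ q))) v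
soundᴿ (𝓡-𝐒 {g = g} {h}) (v ∷ w ∷ []) =
  infer₂ (λ α → next (next ((α ⊔ ω ⊕ α) ⊔ next α))) (λ {α} σ p q →
    ≐-inv p >>= λ (k , m⇓k , _) → ≐-inv q >>= λ (_ , r , _) →
      -- Evaluation unfolds the recursor at the numeral `num k`, whereas the rule mentions `m`
      -- itself; extensionality passes from one to the other.
      let m~k = val (weaken-⊔ˡ m⇓k) (Val-⊔ω-num k)
          h~h = ~-refl (sub σ h)
      in ≐-intro
           (intro (head (𝓡𝐒-head (weaken-⊔ʳ (intro (succ m⇓k))))
             (weaken-⊔ˡ (Val-~ α r (h~h · m~k · (rec · ~-refl (sub σ g) · h~h · m~k))))))
           (weaken-next (weaken-⊔ʳ (weaken-next r)))) v w
soundᴿ (𝓐-I {f = f}) ((F , v) ∷ []) =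
  (λ α → next (F (next (α ⊔ ω)))) ,
  λ α σ Γ✓ → intro (all₁ λ k →
    Holds-≡ (cong (_· num k) (sub-ren f))
      (v _ (num k ▸ σ)
        (≐-intro (Val-⊔ω-num k) (Val-⊔ω-num k) ∷
         map⁺ (All.map (λ {t} p → Holds-↑ (num k) t (weaken-next (weaken-⊔ˡ p))) Γ✓))))
soundᴿ (𝓐-E {f = f}) (v ∷ w ∷ []) =
  infer₂ (λ α → α ⊔ ω ⊕ α) (λ {α} σ p q → ≐-inv q >>= λ (m , r , _) →
    Val-~ α (𝓐-inv₁ p m) (~-refl (sub σ f) · val (Val-⊔ω-num m) (weaken-⊔ˡ r))) v w
soundᴿ (¬𝓐-I {f = f}) (v ∷ w ∷ []) =
  infer₂ (λ α → next (next (α ⊔ ω ⊕ α))) (λ {α} σ p q → ≐-inv q >>= λ (m , r , _) →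
    intro (not₁ (intro (all₀ m
      (Val-~ α (¬-inv₁ p) (~-refl (sub σ f) · val (weaken-⊔ˡ r) (Val-⊔ω-num m))))))) v w
soundᴿ (¬𝓐-E {f = f} {c}) ((F , v) ∷ (G , w) ∷ []) =
  (λ α → G (next (α ⊔ F α ⊔ ω))) ,
  -- The counterexample `k` is known only up to double negation, which suffices because the stage of
  -- the conclusion does not mention it.
  λ α σ Γ✓ → 𝓐-inv₀ (¬-inv₁ (v α σ Γ✓)) >>= λ (k , p) →
    Holds-≡ (sub-ren c)
      (w _ (num k ▸ σ)
        (≐-intro (Val-⊔ω-num k) (Val-⊔ω-num k) ∷
         Holds-≡ (cong (λ t → ¬̇ (t · num k)) (sym (sub-ren f)))
           (intro (not₁ (weaken-⊔ˡ (weaken-⊔ʳ p)))) ∷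
         map⁺ (All.map (λ {t} p → Holds-↑ (num k) t
           (weaken-next (weaken-⊔ˡ (weaken-⊔ˡ p)))) Γ✓)))

soundᴼ : ∀ {ps J} → ps ⟹ᴼ J → All Valid ps → Valid J
soundᴼ (rga r) vs       = soundᴿ r vs
soundᴼ ATI     (v ∷ []) = sound-ATI v

Valid-≋ : ∀ {J J′} → J ≋ J′ → Valid J′ → Valid J
Valid-≋ {Γ ⊢ c} {Δ ⊢ .c} (Γ∼Δ , refl) (F , v) =
  F , λ α σ Γ✓ →
    v α σ (All.tabulate λ x∈Δ → All.lookup Γ✓ (Equivalence.from Γ∼Δ x∈Δ))

occurs⇒Valid : ∀ {π J} → All Valid π → J occursIn π → Valid J
occurs⇒Valid (v ∷ _)  (here J≋) = Valid-≋ J≋ v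
occurs⇒Valid (_ ∷ vs) (there o) = occurs⇒Valid vs o

proof⇒Valid : ∀ {π} → OGAProof π → All Valid π
proof⇒Valid [] = []
proof⇒Valid (step π r os) =
  soundᴼ r (All.map (occurs⇒Valid (proof⇒Valid π)) os) ∷ proof⇒Valid π

derivable⇒Valid : ∀ {J} → OGA-Derivable J → Valid J
derivable⇒Valid (_ , π , o) = occurs⇒Valid (proof⇒Valid π) o

-- From ω-truth to stages, and consistency

Head-·* : ∀ {P t t′} ss → Head P t t′ → Head P (t ·* ss) (t′ ·* ss)
Head-·* []       h = h
Head-·* (s ∷ ss) h = Head-·* ss (app h)

-- The stage is read off the derivation: trees branching over ℕ match the infinitary clause for `𝓐`,
-- and `⇓⇒Val₂` brings two premises to a common stage.
⇓⇒Val : ∀ {t n} → t ⇓ n → ∃[ α ] Val α t n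
⇓⇒Val₂ : ∀ {t u m n} → t ⇓ m → u ⇓ n → ∃[ α ] Val α t m × Val α u n

⇓⇒Val ⇓𝟎 = _ , Val-num 0
⇓⇒Val (⇓𝐒 p) with _ , v ← ⇓⇒Val p = _ , intro (succ v)
⇓⇒Val (⇓≐₁ p q refl) with _ , v , w ← ⇓⇒Val₂ p q = _ , intro (eq₁ v w)
⇓⇒Val (⇓≐₀ p q m≢n) with _ , v , w ← ⇓⇒Val₂ p q = _ , intro (eq₀ v w m≢n)
⇓⇒Val (⇓¬₀ p) with _ , v ← ⇓⇒Val p = _ , intro (not₀ v)
⇓⇒Val (⇓¬₁ p) with _ , v ← ⇓⇒Val p = _ , intro (not₁ v)
⇓⇒Val (⇓∨ˡ p) with _ , v ← ⇓⇒Val p = _ , intro (orˡ v)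
⇓⇒Val (⇓∨ʳ p) with _ , v ← ⇓⇒Val p = _ , intro (orʳ v)
⇓⇒Val (⇓∨₀ p q) with _ , v , w ← ⇓⇒Val₂ p q = _ , intro (or₀ v w)
⇓⇒Val (⇓β ss p) with _ , v ← ⇓⇒Val p = _ , intro (head (Head-·* ss β-head) v)
⇓⇒Val (⇓𝓡𝟎 ss p q) with _ , v , w ← ⇓⇒Val₂ p q =
  _ , intro (head (Head-·* ss (𝓡𝟎-head v)) w)
⇓⇒Val (⇓𝓡𝐒 ss p q) with _ , v , w ← ⇓⇒Val₂ p q =
  _ , intro (head (Head-·* ss (𝓡𝐒-head v)) w)
⇓⇒Val (⇓𝓐₁ p) =
  -- Each instance comes with its own stage; the implicit argument is this family, and its supremum
  -- is a stage for all instances.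
  _ , intro (all₁ λ k → Val-⊆-sup {proj₁ ∘ ⇓⇒Val ∘ p} k (proj₂ (⇓⇒Val (p k))))
⇓⇒Val (⇓𝓐₀ k p) with _ , v ← ⇓⇒Val p = _ , intro (all₀ k v)

⇓⇒Val₂ p q with α , v ← ⇓⇒Val p | δ , w ← ⇓⇒Val q = α ⊔ δ , weaken-⊔ˡ v , weaken-⊔ʳ w

adoptable⇒Holds : ∀ {E} → All CertifiedAdoptable E → ∃[ α ] All (Holds α var) E
adoptable⇒Holds [] = leaf , []
adoptable⇒Holds (_∷_ {x = t} (_ , t⇓1) certified)
  with α , v ← ⇓⇒Val t⇓1 | δ , vs ← adoptable⇒Holds certified =
  α ⊔ δ , weaken-⊔ˡ (Holds-≡ (sym (sub-var t)) v) ∷ All.map weaken-⊔ʳ vs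

theorem6p9 : (E₁ E₂ : List Term) →
    All CertifiedAdoptable E₁ →
    All CertifiedAdoptable E₂ →
    ¬ (∃[ c ] (OGA-Derivable (E₁ ++ E₂ ⊢ c) × OGA-Derivable (E₁ ++ E₂ ⊢ ¬̇ c)))
theorem6p9 E₁ E₂ certified₁ certified₂ (c , ⊢c , ⊢¬c)
  with α , E✓ ← adoptable⇒Holds (++⁺ certified₁ certified₂)
     | _ , v ← derivable⇒Valid ⊢c
     | _ , w ← derivable⇒Valid ⊢¬c
  -- At the identity substitution `c` would have both value 1 and value 0; `det` applies although
  -- the two derivations give different bounds.
  with () ← det (v α var E✓) (¬-inv₁ (w α var E✓))
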